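{- Let $n\ge1$ and $k$ be integers. If the complete bipartite graph $K_{n,n}$ is $k$-removable, then $k> n-\sqrt{2n(\log n+1)}$.
   Context: $\log$ is the natural logarithm. For a graph $G$, $f:V(G)\to\mathbb Z$, $u\in V(G)$ and $W\subseteq N(u)$, $\mathsf{DelSave}(G,f,u,W)$ outputs $G'=G-u$ and $f'$ with $f'(x)=f(x)-1$ for $x\in N(u)\setminus W$ and $f'(x)=f(x)$ otherwise; it is legal if $f(u)>\sum_{w\in W}f(w)$ and $f'(x)\ge1$ for all $x\in V(G')$. $G$ is $f$-removable if all vertices can be deleted by successive legal $\mathsf{DelSave}$ applications, each time replacing $(G,f)$ by the output; $G$ is $k$-removable if it is $f$-removable for the constant function $f\equiv k$. -}

module Defs where

open import Data.Bool.Base using (Bool; true; false; if_then_else_)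
open import Data.Bool.Properties using () renaming (_≟_ to _≟ᵇ_)
open import Data.Empty using (⊥; ⊥-elim)
open import Data.Fin.Base using (Fin; splitAt; punchIn)
open import Data.Fin.Subset using (Subset; _∈_)
open import Data.Fin.Subset.Properties using (_∈?_)
open import Data.Integer.Base as ℤ using (ℤ; +_; +[1+_]; -[1+_]; 1ℤ; 0ℤ)
import Data.Integer.Properties as ℤₚ
open import Algebra.Properties.CommutativeMonoid.Sum ℤₚ.+-0-commutativeMonoid
  using (sum)
open import Data.Nat.Base as ℕ using (ℕ; zero; suc; NonZero)
import Data.Nat.Properties as ℕₚ
open import Data.Product.Base using (∃; ∃₂; _×_; _,_; proj₁; proj₂)
open import Data.Rational.Base as ℚ
  using (ℚ; mkℚ; _/_; _+_; _*_; -_; _-_; _<_; _≤_; 0ℚ; 1ℚ; ½; toℚᵘ; 1/_; *<*; *≤*)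
import Data.Rational.Properties as ℚₚ
open import Data.Rational.Solver using (module +-*-Solver)
import Data.Rational.Unnormalised.Base as ℚᵘ
import Data.Rational.Unnormalised.Properties as ℚᵘₚ
open import Data.Sum.Base using (_⊎_; inj₁; inj₂; [_,_]′; swap)
open import Function.Base using (_∘_; const)
open import Level using (0ℓ)
open import Relation.Binary.Core using (Rel)
open import Relation.Binary.Definitions using (Decidable; Symmetric; Irreflexive; tri<; tri≈; tri>)
open import Relation.Binary.PropositionalEquality
  using (_≡_; _≢_; refl; sym; trans; cong; cong₂; subst; subst₂)
open import Relation.Nullary using (does; yes; no)
open import Relation.Nullary.Decidable using (¬?; _×-dec_)

------------------------------------------------------------------------
-- Graphs and removability

-- Finite simple graphs, with vertex set Fin n.

record Graph (n : ℕ) : Set₁ where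
  infix 4 _~_ _~?_
  field
    _~_    : Rel (Fin n) 0ℓ
    _~?_   : Decidable _~_
    ~-sym  : Symmetric _~_
    ~-irr  : Irreflexive _≡_ _~_

-- The vertices of deleteVertex G u are renumbered: its vertex x is the vertex
-- punchIn u x of G, where punchIn u enumerates the vertices other than u.

deleteVertex : ∀ {n} → Graph (suc n) → Fin (suc n) → Graph n
deleteVertex G u = record
  { _~_   = λ x y → punchIn u x ~ punchIn u y
  ; _~?_  = λ x y → punchIn u x ~? punchIn u y
  ; ~-sym = ~-sym
  ; ~-irr = λ { refl → ~-irr refl }
  }
  where open Graph G

saveWeights : ∀ {n} → Graph (suc n) → (Fin (suc n) → ℤ) →
              Fin (suc n) → Subset (suc n) → Fin n → ℤ
saveWeights G f u W x =
  if does ((u ~? y) ×-dec ¬? (y ∈? W)) then f y ℤ.- 1ℤ else f y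
  where
    open Graph G
    y = punchIn u x

∑[_] : ∀ {n} → Subset n → (Fin n → ℤ) → ℤ
∑[ W ] f = sum (λ w → if does (w ∈? W) then f w else 0ℤ)

record Legal {n} (G : Graph (suc n)) (f : Fin (suc n) → ℤ)
             (u : Fin (suc n)) (W : Subset (suc n)) : Set where
  open Graph G
  field
    W⊆N      : ∀ {w} → w ∈ W → u ~ w
    saves    : ∑[ W ] f ℤ.< f u
    positive : ∀ x → 1ℤ ℤ.≤ saveWeights G f u W x

data Removable : ∀ {n} → Graph n → (Fin n → ℤ) → Set₁ where
  done    : {G : Graph 0} {f : Fin 0 → ℤ} → Removable G f
  delSave : ∀ {n} {G : Graph (suc n)} {f : Fin (suc n) → ℤ}
            (u : Fin (suc n)) (W : Subset (suc n)) → Legal G f u W →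
            Removable (deleteVertex G u) (saveWeights G f u W) →
            Removable G f

_-removable : ℤ → ∀ {n} → Graph n → Set₁
(k -removable) G = Removable G (const k)

leftPart : ∀ m {n} → Fin (m ℕ.+ n) → Bool
leftPart m = [ const true , const false ]′ ∘ splitAt m

K : ∀ m n → Graph (m ℕ.+ n)
K m n = record
  { _~_   = λ x y → leftPart m x ≢ leftPart m y
  ; _~?_  = λ x y → ¬? (leftPart m x ≟ᵇ leftPart m y)
  ; ~-sym = λ x≢y → x≢y ∘ sym
  ; ~-irr = λ { refl x≢x → x≢x refl }
  }

------------------------------------------------------------------------
-- Dedekind reals: L q means q < x, and U q means x < q.

record ℝ : Set₁ where
  field
    L U      : ℚ → Set
    L-inhab  : ∃ L
    U-inhab  : ∃ U
    L-closed : ∀ {p q} → p < q → L q → L p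
    U-closed : ∀ {p q} → p < q → U p → U q
    L-open   : ∀ {p} → L p → ∃ λ q → p < q × L q
    U-open   : ∀ {q} → U q → ∃ λ p → p < q × U p
    disjoint : ∀ {q} → L q → U q → ⊥
    located  : ∀ {p q} → p < q → L p ⊎ U q

infix 4 _<ℝ_

_<ℝ_ : ℝ → ℝ → Set
x <ℝ y = ∃ λ q → ℝ.U x q × ℝ.L y q

------------------------------------------------------------------------
-- Rational arithmetic

open +-*-Solver

by-gap : ∀ {p q} d → 0ℚ < d → p + d ≡ q → p < q
by-gap {p} d 0<d eq =
  subst₂ _<_ (ℚₚ.+-identityʳ p) eq (ℚₚ.+-monoʳ-< p 0<d)

gap : ∀ {p q} → p < q → 0ℚ < q - p
gap {p} {q} p<q =
  subst (_< q - p) (ℚₚ.+-inverseʳ p) (ℚₚ.+-monoˡ-< (- p) p<q)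

p-1<p : ∀ p → p - 1ℚ < p
p-1<p p = by-gap 1ℚ (*<* (ℤ.+<+ (ℕ.s≤s ℕ.z≤n)))
  (solve 1 (λ p → p :- con 1ℚ :+ con 1ℚ := p) refl p)

p<p+1 : ∀ p → p < p + 1ℚ
p<p+1 p = by-gap 1ℚ (*<* (ℤ.+<+ (ℕ.s≤s ℕ.z≤n))) refl

*-pos : ∀ {p q} → 0ℚ < p → 0ℚ < q → 0ℚ < p * q
*-pos {p} {q} 0<p 0<q =
  subst (_< p * q) (ℚₚ.*-zeroʳ p) (ℚₚ.*-monoʳ-<-pos p {{ℚ.positive 0<p}} 0<q)

+-pos : ∀ {p q} → 0ℚ ≤ p → 0ℚ < q → 0ℚ < p + q
+-pos 0≤p 0<q = ℚₚ.+-mono-≤-< 0≤p 0<q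

0<1 : 0ℚ < 1ℚ
0<1 = *<* (ℤ.+<+ (ℕ.s≤s ℕ.z≤n))

0<½ : 0ℚ < ½
0<½ = *<* (ℤ.+<+ (ℕ.s≤s ℕ.z≤n))

half-sum : ∀ p → ½ * p + ½ * p ≡ p
half-sum p = trans (sym (ℚₚ.*-distribʳ-+ p ½ ½)) (ℚₚ.*-identityˡ p)

sq-mono-< : ∀ {p q} → 0ℚ ≤ p → p < q → p * p < q * q
sq-mono-< {p} {q} 0≤p p<q = ℚₚ.≤-<-trans
  (ℚₚ.*-monoˡ-≤-nonNeg p {{ℚ.nonNegative 0≤p}} (ℚₚ.<⇒≤ p<q))
  (ℚₚ.*-monoˡ-<-pos q {{ℚ.positive (ℚₚ.≤-<-trans 0≤p p<q)}} p<q)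

sq-nonNeg : ∀ p → 0ℚ ≤ p * p
sq-nonNeg p with ℚₚ.≤-total 0ℚ p
... | inj₁ 0≤p = subst (_≤ p * p) (ℚₚ.*-zeroʳ p)
                   (ℚₚ.*-monoˡ-≤-nonNeg p {{ℚ.nonNegative 0≤p}} 0≤p)
... | inj₂ p≤0 = subst (_≤ p * p) (ℚₚ.*-zeroʳ p)
                   (ℚₚ.*-monoˡ-≤-nonPos p {{ℚ.nonPositive p≤0}} p≤0)

inverse : ∀ p → 0ℚ < p → ∃ λ r → 0ℚ < r × p * r ≡ 1ℚ
inverse p 0<p = 1/ p , ℚₚ.positive⁻¹ (1/ p) {{ℚₚ.1/pos⇒pos p}} , ℚₚ.*-inverseʳ p
  where instance
    _ = ℚ.positive 0<p
    _ = ℚₚ.pos⇒nonZero p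

sq-up : ∀ {p r} → 0ℚ ≤ p → p * p < r → ∃ λ q → p < q × q * q ≤ r
sq-up {p} {r} 0≤p p²<r = go (inverse D (ℚₚ.<-≤-trans 0<1 1≤D))
  where
    s = r - p * p
    D = (p + p + s) + 1ℚ

    0<s : 0ℚ < s
    0<s = gap p²<r

    1≤D : 1ℚ ≤ D
    1≤D = subst (_≤ D) (ℚₚ.+-identityˡ 1ℚ)
      (ℚₚ.+-monoˡ-≤ 1ℚ (ℚₚ.<⇒≤ (+-pos (ℚₚ.+-mono-≤ 0≤p 0≤p) 0<s)))

    go : (∃ λ i → 0ℚ < i × D * i ≡ 1ℚ) → ∃ λ q → p < q × q * q ≤ r
    go (i , 0<i , Di≡1) = p + δ , by-gap δ 0<δ refl , subst₂ _≤_ lhs rhs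
        (ℚₚ.+-monoʳ-≤ (p * p) (ℚₚ.*-monoˡ-≤-nonNeg δ {{ℚ.nonNegative (ℚₚ.<⇒≤ 0<δ)}}
          (ℚₚ.≤-trans (ℚₚ.+-monoʳ-≤ (p + p) δ≤s) (ℚₚ.<⇒≤ (p<p+1 (p + p + s))))))
      where
        δ = s * i
        0<δ : 0ℚ < δ
        0<δ = *-pos 0<s 0<i

        i≤1 : i ≤ 1ℚ
        i≤1 = subst₂ _≤_ (ℚₚ.*-identityˡ i) Di≡1
          (ℚₚ.*-monoʳ-≤-nonNeg i {{ℚ.nonNegative (ℚₚ.<⇒≤ 0<i)}} 1≤D)

        δ≤s : δ ≤ s
        δ≤s = subst (δ ≤_) (ℚₚ.*-identityʳ s)
          (ℚₚ.*-monoˡ-≤-nonNeg s {{ℚ.nonNegative (ℚₚ.<⇒≤ 0<s)}} i≤1)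

        lhs : p * p + δ * (p + p + δ) ≡ (p + δ) * (p + δ)
        lhs = solve 2 (λ p d → p :* p :+ d :* (p :+ p :+ d) := (p :+ d) :* (p :+ d))
                refl p δ

        δD≡s : δ * D ≡ s
        δD≡s = trans (solve 3 (λ s i D → s :* i :* D := s :* (D :* i)) refl s i D)
          (trans (cong (s *_) Di≡1) (ℚₚ.*-identityʳ s))

        rhs : p * p + δ * D ≡ r
        rhs = trans (cong (λ z → p * p + z) δD≡s)
          (solve 2 (λ a r → a :+ (r :- a) := r) refl (p * p) r)

sq-down : ∀ {q r} → 0ℚ < q → 0ℚ < r → r < q * q →
          ∃ λ p → 0ℚ < p × p < q × r ≤ p * p
sq-down {q} {r} 0<q 0<r r<q² = go (inverse q 0<q)
  where
    go : (∃ λ i → 0ℚ < i × q * i ≡ 1ℚ) → ∃ λ p → 0ℚ < p × p < q × r ≤ p * p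
    go (i , 0<i , qi≡1) =
        t + h
      , ℚₚ.+-mono-< (*-pos 0<r 0<i) 0<h
      , by-gap h 0<h (trans (ℚₚ.+-assoc t h h) q≡)
      , subst₂ _≤_ (ℚₚ.+-identityʳ r) sq (ℚₚ.+-monoʳ-≤ r (sq-nonNeg h))
      where
        t = r * i
        h = ½ * (q - t)

        t<q : t < q
        t<q = subst (t <_)
          (trans (ℚₚ.*-assoc q q i) (trans (cong (q *_) qi≡1) (ℚₚ.*-identityʳ q)))
          (ℚₚ.*-monoˡ-<-pos i {{ℚ.positive 0<i}} r<q²)

        0<h : 0ℚ < h
        0<h = *-pos 0<½ (gap t<q)

        q≡ : t + (h + h) ≡ q
        q≡ = trans (cong (λ z → t + z) (half-sum (q - t)))
          (solve 2 (λ t q → t :+ (q :- t) := q) refl t q)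

        qt≡r : q * t ≡ r
        qt≡r = trans (solve 3 (λ q r i → q :* (r :* i) := r :* (q :* i)) refl q r i)
          (trans (cong (r *_) qi≡1) (ℚₚ.*-identityʳ r))

        sq : r + h * h ≡ (t + h) * (t + h)
        sq = trans (cong (λ z → z + h * h) (trans (sym qt≡r) (cong (_* t) (sym q≡))))
          (solve 2 (λ t h → (t :+ (h :+ h)) :* t :+ h :* h := (t :+ h) :* (t :+ h))
            refl t h)

-- 1/(d+1)
recip : ℕ → ℚ
recip d = + 1 / suc d

recip-pos : ∀ d → 0ℚ < recip d
recip-pos d = ℚₚ.positive⁻¹ (recip d) {{ℚₚ.normalize-pos 1 (suc d)}}

recip-antimono : ∀ {a b} → a ℕ.≤ b → recip b ≤ recip a
recip-antimono {a} {b} a≤b = ℚₚ.toℚᵘ-cancel-≤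
  (ℚᵘₚ.≤-respˡ-≃ (ℚᵘₚ.≃-sym (ℚₚ.toℚᵘ-fromℚᵘ (ℚᵘ.mkℚᵘ (+ 1) b)))
  (ℚᵘₚ.≤-respʳ-≃ (ℚᵘₚ.≃-sym (ℚₚ.toℚᵘ-fromℚᵘ (ℚᵘ.mkℚᵘ (+ 1) a)))
  (ℚᵘ.*≤* (ℤ.+≤+ (ℕₚ.*-monoʳ-≤ 1 (ℕ.s≤s a≤b))))))

recip-small : ∀ {ε} → 0ℚ < ε → ∃ λ d → recip d < ε
recip-small {mkℚ +[1+ a ] d _} _ = suc d , ℚₚ.toℚᵘ-cancel-<
  (ℚᵘₚ.<-respˡ-≃ (ℚᵘₚ.≃-sym (ℚₚ.toℚᵘ-fromℚᵘ (ℚᵘ.mkℚᵘ (+ 1) (suc d))))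
  (ℚᵘ.*<* (ℤ.+<+ (ℕₚ.≤-trans (ℕₚ.≤-reflexive (cong suc (ℕₚ.*-identityˡ (suc d))))
                               (ℕₚ.m≤n*m (suc (suc d)) (suc a))))))
recip-small {mkℚ (+ 0)     d _} (*<* (ℤ.+<+ ()))
recip-small {mkℚ -[1+ a ] d _} (*<* ())

infixr 8 _×ℚ_

_×ℚ_ : ℕ → ℚ → ℚ
zero  ×ℚ p = 0ℚ
suc n ×ℚ p = p + n ×ℚ p

×ℚ-recip : ∀ n d → n ×ℚ recip d ≡ + n / suc d
×ℚ-recip zero    d = sym (ℚₚ.0/n≡0 (suc d))
×ℚ-recip (suc n) d = trans (cong (λ z → recip d + z) (×ℚ-recip n d)) (ℚₚ.toℚᵘ-injective
  (ℚᵘₚ.≃-trans (ℚₚ.toℚᵘ-homo-+ (recip d) (+ n / suc d))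
  (ℚᵘₚ.≃-trans (ℚᵘₚ.+-cong (ℚₚ.toℚᵘ-fromℚᵘ (ℚᵘ.mkℚᵘ (+ 1) d))
                            (ℚₚ.toℚᵘ-fromℚᵘ (ℚᵘ.mkℚᵘ (+ n) d)))
  (ℚᵘₚ.≃-trans (ℚᵘ.*≡* eq) (ℚᵘₚ.≃-sym (ℚₚ.toℚᵘ-fromℚᵘ (ℚᵘ.mkℚᵘ (+ suc n) d)))))))
  where
    D = + suc d
    eq : (1ℤ ℤ.* D ℤ.+ + n ℤ.* D) ℤ.* D ≡ + suc n ℤ.* (D ℤ.* D)
    eq = trans (cong (ℤ._* D) (sym (ℤₚ.*-distribʳ-+ D 1ℤ (+ n))))
               (ℤₚ.*-assoc (+ suc n) D D)

×ℚ-block : ∀ m κ → suc κ ×ℚ recip (κ ℕ.+ m ℕ.* suc κ) ≡ recip m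
×ℚ-block m κ = trans (×ℚ-recip (suc κ) (κ ℕ.+ m ℕ.* suc κ))
  (ℚₚ.fromℚᵘ-cong {ℚᵘ.mkℚᵘ (+ suc κ) (κ ℕ.+ m ℕ.* suc κ)} {ℚᵘ.mkℚᵘ (+ 1) m}
    (ℚᵘ.*≡* (trans (ℤₚ.*-comm (+ suc κ) (+ suc m))
      (sym (ℤₚ.*-identityˡ (+ suc m ℤ.* + suc κ))))))

×ℚ-assoc : ∀ n p q → (n ×ℚ p) * q ≡ n ×ℚ (p * q)
×ℚ-assoc zero    p q = ℚₚ.*-zeroˡ q
×ℚ-assoc (suc n) p q =
  trans (ℚₚ.*-distribʳ-+ q p (n ×ℚ p)) (cong (λ z → p * q + z) (×ℚ-assoc n p q))

archimedean : ∀ p {δ} → 0ℚ < δ → ∃ λ n → p ≤ n ×ℚ δ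
archimedean p {δ} 0<δ = go (inverse δ 0<δ)
  where
    bound : ∀ r → ∃ λ n → r ≤ n ×ℚ 1ℚ
    bound (mkℚ (+ n) d c) = n , subst (mkℚ (+ n) d c ≤_) (sym (×ℚ-recip n 0))
      (ℚₚ.toℚᵘ-cancel-≤ (ℚᵘₚ.≤-respʳ-≃ (ℚᵘₚ.≃-sym (ℚₚ.toℚᵘ-fromℚᵘ (ℚᵘ.mkℚᵘ (+ n) 0)))
        (ℚᵘ.*≤* (subst₂ ℤ._≤_ (ℤₚ.pos-* n 1) (ℤₚ.pos-* n (suc d))
          (ℤ.+≤+ (ℕₚ.*-monoʳ-≤ n (ℕ.s≤s ℕ.z≤n)))))))
    bound (mkℚ -[1+ n ] d c) = 0 , *≤* ℤ.-≤+

    go : (∃ λ r → 0ℚ < r × δ * r ≡ 1ℚ) → ∃ λ n → p ≤ n ×ℚ δ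
    go (r , _ , δr≡1) with bound (p * r)
    ... | n , pr≤n = n , subst₂ _≤_ eq₁ eq₂
            (ℚₚ.*-monoʳ-≤-nonNeg δ {{ℚ.nonNegative (ℚₚ.<⇒≤ 0<δ)}} pr≤n)
      where
        eq₁ : p * r * δ ≡ p
        eq₁ = trans (ℚₚ.*-assoc p r δ)
          (trans (cong (p *_) (trans (ℚₚ.*-comm r δ) δr≡1)) (ℚₚ.*-identityʳ p))
        eq₂ : (n ×ℚ 1ℚ) * δ ≡ n ×ℚ δ
        eq₂ = trans (×ℚ-assoc n 1ℚ δ) (cong (n ×ℚ_) (ℚₚ.*-identityˡ δ))

------------------------------------------------------------------------
-- Properties of a single real

module ℝ-Properties (x : ℝ) where
  open ℝ x

  L<U : ∀ {p q} → L p → U q → p < q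
  L<U {p} {q} Lp Uq with ℚₚ.<-cmp p q
  ... | tri< p<q _ _ = p<q
  ... | tri≈ _ refl _ = ⊥-elim (disjoint Lp Uq)
  ... | tri> _ _ q<p = ⊥-elim (disjoint Lp (U-closed q<p Uq))

  U-closed-≤ : ∀ {p q} → p ≤ q → U p → U q
  U-closed-≤ {p} {q} p≤q Up with ℚₚ.<-cmp p q
  ... | tri< p<q _ _ = U-closed p<q Up
  ... | tri≈ _ refl _ = Up
  ... | tri> _ _ q<p = ⊥-elim (ℚₚ.<-irrefl refl (ℚₚ.<-≤-trans q<p p≤q))

  L-closed-≤ : ∀ {p q} → p ≤ q → L q → L p
  L-closed-≤ {p} {q} p≤q Lq with ℚₚ.<-cmp p q
  ... | tri< p<q _ _ = L-closed p<q Lq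
  ... | tri≈ _ refl _ = Lq
  ... | tri> _ _ q<p = ⊥-elim (ℚₚ.<-irrefl refl (ℚₚ.<-≤-trans q<p p≤q))

  approx : ∀ {ε} → 0ℚ < ε → ∃₂ λ p q → L p × U q × q < p + ε
  approx {ε} 0<ε with ℚₚ.<-dense 0<ε
  ... | η , 0<η , η<ε with archimedean (proj₁ U-inhab - proj₁ L-inhab) {½ * η} (*-pos 0<½ 0<η)
  ... | n , b-a≤nδ = walk n (proj₁ L-inhab) (proj₂ L-inhab)
          (U-closed-≤ b≤a+nδ (proj₂ U-inhab))
    where
      δ = ½ * η
      0<δ : 0ℚ < δ
      0<δ = *-pos 0<½ 0<η

      b≤a+nδ : proj₁ U-inhab ≤ proj₁ L-inhab + n ×ℚ δ
      b≤a+nδ = subst (_≤ proj₁ L-inhab + n ×ℚ δ)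
        (solve 2 (λ a b → a :+ (b :- a) := b) refl (proj₁ L-inhab) (proj₁ U-inhab))
        (ℚₚ.+-monoʳ-≤ (proj₁ L-inhab) b-a≤nδ)

      c+δ+δ<c+ε : ∀ c → c + δ + δ < c + ε
      c+δ+δ<c+ε c = subst (_< c + ε)
        (trans (cong (λ z → c + z) (sym (half-sum η))) (sym (ℚₚ.+-assoc c δ δ)))
        (ℚₚ.+-monoʳ-< c η<ε)

      walk : ∀ n c → L c → U (c + n ×ℚ δ) → ∃₂ λ p q → L p × U q × q < p + ε
      walk zero    c Lc Uc = ⊥-elim (disjoint Lc (subst U (ℚₚ.+-identityʳ c) Uc))
      walk (suc n) c Lc Uc with located (by-gap {c + δ} δ 0<δ refl)
      ... | inj₁ Lc+δ  = walk n (c + δ) Lc+δ (subst U (sym (ℚₚ.+-assoc c δ (n ×ℚ δ))) Uc)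
      ... | inj₂ Uc+2δ = c , c + δ + δ , Lc , Uc+2δ , c+δ+δ<c+ε c

------------------------------------------------------------------------
-- Arithmetic of reals

fromℚ : ℚ → ℝ
fromℚ r = record
  { L        = _< r
  ; U        = r <_
  ; L-inhab  = r - 1ℚ , p-1<p r
  ; U-inhab  = r + 1ℚ , p<p+1 r
  ; L-closed = ℚₚ.<-trans
  ; U-closed = λ p<q r<p → ℚₚ.<-trans r<p p<q
  ; L-open   = ℚₚ.<-dense
  ; U-open   = λ r<q → let (p , r<p , p<q) = ℚₚ.<-dense r<q in p , p<q , r<p
  ; disjoint = ℚₚ.<-asym
  ; located  = located
  }
  where
    located : ∀ {p q} → p < q → p < r ⊎ r < q
    located {p} p<q with p ℚₚ.<? r
    ... | yes p<r = inj₁ p<r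
    ... | no  p≮r = inj₂ (ℚₚ.≤-<-trans (ℚₚ.≮⇒≥ p≮r) p<q)

fromℤ : ℤ → ℝ
fromℤ z = fromℚ (z / 1)

infixl 6 _+ℝ_ _-ℝ_
infix  8 -ℝ_
infixr 7 _·_

_+ℝ_ : ℝ → ℝ → ℝ
x +ℝ y = record
  { L        = λ q → ∃₂ λ a b → X.L a × Y.L b × q < a + b
  ; U        = λ q → ∃₂ λ a b → X.U a × Y.U b × a + b < q
  ; L-inhab  = let (a , La) = X.L-inhab ; (b , Lb) = Y.L-inhab in
               a + b - 1ℚ , a , b , La , Lb , p-1<p (a + b)
  ; U-inhab  = let (a , Ua) = X.U-inhab ; (b , Ub) = Y.U-inhab in
               a + b + 1ℚ , a , b , Ua , Ub , p<p+1 (a + b)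
  ; L-closed = λ { p<q (a , b , La , Lb , q<) → a , b , La , Lb , ℚₚ.<-trans p<q q< }
  ; U-closed = λ { p<q (a , b , Ua , Ub , <p) → a , b , Ua , Ub , ℚₚ.<-trans <p p<q }
  ; L-open   = λ { (a , b , La , Lb , p<) → let (q , p<q , q<) = ℚₚ.<-dense p< in
                   q , p<q , a , b , La , Lb , q< }
  ; U-open   = λ { (a , b , Ua , Ub , <q) → let (p , <p , p<q) = ℚₚ.<-dense <q in
                   p , p<q , a , b , Ua , Ub , <p }
  ; disjoint = λ { (a , b , La , Lb , q<) (c , d , Uc , Ud , <q) →
                   ℚₚ.<-asym (ℚₚ.+-mono-< (XP.L<U La Uc) (YP.L<U Lb Ud))
                             (ℚₚ.<-trans <q q<) }
  ; located  = located
  }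
  where
    module X = ℝ x
    module Y = ℝ y
    module XP = ℝ-Properties x
    module YP = ℝ-Properties y

    located : ∀ {p q} → p < q →
              (∃₂ λ a b → X.L a × Y.L b × p < a + b) ⊎
              (∃₂ λ a b → X.U a × Y.U b × a + b < q)
    located {p} {q} p<q =
      combine (XP.approx 0<ε) (YP.approx 0<ε)
      where
        ε = ½ * (q - p)
        0<ε : 0ℚ < ε
        0<ε = *-pos 0<½ (gap p<q)

        eq₁ : ∀ a b → a + b + (q - p) ≡ (a + ε) + (b + ε)
        eq₁ a b = trans (cong (λ e → a + b + e) (sym (half-sum (q - p))))
          (solve 3 (λ a b h → a :+ b :+ (h :+ h) := (a :+ h) :+ (b :+ h)) refl a b ε)
        eq₂ : p + (q - p) ≡ q
        eq₂ = solve 2 (λ p q → p :+ (q :- p) := q) refl p q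

        combine : (∃₂ λ a c → X.L a × X.U c × c < a + ε) →
                  (∃₂ λ b d → Y.L b × Y.U d × d < b + ε) →
                  (∃₂ λ a b → X.L a × Y.L b × p < a + b) ⊎
                  (∃₂ λ a b → X.U a × Y.U b × a + b < q)
        combine (a , c , La , Uc , c<a+ε) (b , d , Lb , Ud , d<b+ε) with p ℚₚ.<? a + b
        ... | yes p<a+b = inj₁ (a , b , La , Lb , p<a+b)
        ... | no  p≮a+b = inj₂ (c , d , Uc , Ud ,
                ℚₚ.<-≤-trans (ℚₚ.+-mono-< c<a+ε d<b+ε)
                  (subst₂ _≤_ (eq₁ a b) eq₂ (ℚₚ.+-monoˡ-≤ (q - p) (ℚₚ.≮⇒≥ p≮a+b))))

-ℝ_ : ℝ → ℝ
-ℝ x = record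
  { L        = λ q → U (- q)
  ; U        = λ q → L (- q)
  ; L-inhab  = let (q , Uq) = U-inhab in - q , subst U (sym (neg-neg q)) Uq
  ; U-inhab  = let (q , Lq) = L-inhab in - q , subst L (sym (neg-neg q)) Lq
  ; L-closed = λ p<q → U-closed (ℚₚ.neg-antimono-< p<q)
  ; U-closed = λ p<q → L-closed (ℚₚ.neg-antimono-< p<q)
  ; L-open   = λ {p} Up → let (r , r<-p , Ur) = U-open Up in
                 - r , subst (_< - r) (neg-neg p) (ℚₚ.neg-antimono-< r<-p)
                     , subst U (sym (neg-neg r)) Ur
  ; U-open   = λ {q} Lq → let (r , -q<r , Lr) = L-open Lq in
                 - r , subst (- r <_) (neg-neg q) (ℚₚ.neg-antimono-< -q<r)
                     , subst L (sym (neg-neg r)) Lr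
  ; disjoint = λ Uq Lq → disjoint Lq Uq
  ; located  = λ p<q → swap (located (ℚₚ.neg-antimono-< p<q))
  }
  where
    open ℝ x
    neg-neg : ∀ p → - (- p) ≡ p
    neg-neg = solve 1 (λ p → :- (:- p) := p) refl

_-ℝ_ : ℝ → ℝ → ℝ
x -ℝ y = x +ℝ (-ℝ y)

_·_ : ℕ → ℝ → ℝ
zero  · x = fromℚ 0ℚ
suc n · x = x +ℝ n · x

-- For x ≤ 0 this gives √ x = 0.

infix 8 √_

√_ : ℝ → ℝ
√ x = record
  { L        = λ q → q < 0ℚ ⊎ L (q * q)
  ; U        = λ q → 0ℚ < q × U (q * q)
  ; L-inhab  = - 1ℚ , inj₁ (*<* ℤ.-<+)
  ; U-inhab  = U-inhab′
  ; L-closed = L-closed′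
  ; U-closed = λ { p<q (0<p , Up²) →
                   ℚₚ.<-trans 0<p p<q , U-closed (sq-mono-< (ℚₚ.<⇒≤ 0<p) p<q) Up² }
  ; L-open   = L-open′
  ; U-open   = U-open′
  ; disjoint = λ { (inj₁ q<0) (0<q , _) → ℚₚ.<-asym q<0 0<q
                 ; (inj₂ Lq²) (_ , Uq²) → disjoint Lq² Uq² }
  ; located  = located′
  }
  where
    open ℝ x
    open ℝ-Properties x

    U-inhab′ : ∃ λ q → 0ℚ < q × U (q * q)
    U-inhab′ with 1ℚ ℚₚ.≤? proj₁ U-inhab
    ... | yes 1≤b = b , 0<b , U-closed-≤ b≤b² (proj₂ U-inhab)
      where
        b = proj₁ U-inhab
        0<b : 0ℚ < b
        0<b = ℚₚ.<-≤-trans 0<1 1≤b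
        b≤b² : b ≤ b * b
        b≤b² = subst (_≤ b * b) (ℚₚ.*-identityʳ b)
          (ℚₚ.*-monoˡ-≤-nonNeg b {{ℚ.nonNegative (ℚₚ.<⇒≤ 0<b)}} 1≤b)
    ... | no  1≰b = 1ℚ , 0<1 , U-closed (ℚₚ.≰⇒> 1≰b) (proj₂ U-inhab)

    L-closed′ : ∀ {p q} → p < q → q < 0ℚ ⊎ L (q * q) → p < 0ℚ ⊎ L (p * p)
    L-closed′ p<q (inj₁ q<0) = inj₁ (ℚₚ.<-trans p<q q<0)
    L-closed′ {p} p<q (inj₂ Lq²) with p ℚₚ.<? 0ℚ
    ... | yes p<0 = inj₁ p<0
    ... | no  p≮0 = inj₂ (L-closed (sq-mono-< (ℚₚ.≮⇒≥ p≮0) p<q) Lq²)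

    L-open-neg : ∀ {p} → p < 0ℚ → ∃ λ q → p < q × (q < 0ℚ ⊎ L (q * q))
    L-open-neg p<0 = let (q , p<q , q<0) = ℚₚ.<-dense p<0 in q , p<q , inj₁ q<0

    L-open′ : ∀ {p} → p < 0ℚ ⊎ L (p * p) → ∃ λ q → p < q × (q < 0ℚ ⊎ L (q * q))
    L-open′ (inj₁ p<0) = L-open-neg p<0
    L-open′ {p} (inj₂ Lp²) with p ℚₚ.<? 0ℚ
    ... | yes p<0 = L-open-neg p<0
    ... | no  p≮0 =
      let (r , p²<r , Lr)   = L-open Lp²
          (q , p<q , q²≤r) = sq-up (ℚₚ.≮⇒≥ p≮0) p²<r
      in q , p<q , inj₂ (L-closed-≤ q²≤r Lr)

    U-open-pos : ∀ {q r} → 0ℚ < q → 0ℚ < r → r < q * q → U r →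
                 ∃ λ p → p < q × 0ℚ < p × U (p * p)
    U-open-pos 0<q 0<r r<q² Ur =
      let (p , 0<p , p<q , r≤p²) = sq-down 0<q 0<r r<q²
      in p , p<q , 0<p , U-closed-≤ r≤p² Ur

    U-open′ : ∀ {q} → 0ℚ < q × U (q * q) → ∃ λ p → p < q × 0ℚ < p × U (p * p)
    U-open′ {q} (0<q , Uq²) with U-open Uq²
    ... | r , r<q² , Ur with 0ℚ ℚₚ.<? r
    ... | yes 0<r = U-open-pos 0<q 0<r r<q² Ur
    ... | no  0≮r =
      let (s , 0<s , s<q²) = ℚₚ.<-dense (*-pos 0<q 0<q)
      in U-open-pos 0<q 0<s s<q² (U-closed (ℚₚ.≤-<-trans (ℚₚ.≮⇒≥ 0≮r) 0<s) Ur)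

    located′ : ∀ {p q} → p < q → (p < 0ℚ ⊎ L (p * p)) ⊎ (0ℚ < q × U (q * q))
    located′ {p} p<q with p ℚₚ.<? 0ℚ
    ... | yes p<0 = inj₁ (inj₁ p<0)
    ... | no  p≮0 = [ inj₁ ∘ inj₂ , (λ Uq² → inj₂ (ℚₚ.≤-<-trans 0≤p p<q , Uq²)) ]′
                      (located (sq-mono-< 0≤p p<q))
      where 0≤p = ℚₚ.≮⇒≥ p≮0

------------------------------------------------------------------------
-- Natural logarithm of a positive integer: log n = ∫₁ⁿ dt/t

-- recipSum a c = Σ_{i=1}^{c} 1/(a+i)

recipSum : ℕ → ℕ → ℚ
recipSum a zero    = 0ℚ
recipSum a (suc c) = recip a + recipSum (suc a) c

-- Darboux sums of 1/t over [1,n], cut into (n-1)·m intervals of length 1/m with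
-- m = suc μ.  The interval [j/m, (j+1)/m] contributes (1/m)·(m/(j+1)) = 1/(j+1)
-- to the lower sum and (1/m)·(m/j) = 1/j to the upper sum, for m ≤ j < n·m.

lowerSum upperSum : ℕ → ℕ → ℚ
lowerSum n μ = recipSum (suc μ) ((n ℕ.∸ 1) ℕ.* suc μ)
upperSum n μ = recipSum μ       ((n ℕ.∸ 1) ℕ.* suc μ)

recipSum-++ : ∀ a c d → recipSum a (c ℕ.+ d) ≡ recipSum a c + recipSum (a ℕ.+ c) d
recipSum-++ a zero    d = trans (cong (λ z → recipSum z d) (sym (ℕₚ.+-identityʳ a)))
                                (sym (ℚₚ.+-identityˡ _))
recipSum-++ a (suc c) d = trans (cong (λ z → recip a + z) (recipSum-++ (suc a) c d))
  (trans (sym (ℚₚ.+-assoc (recip a) (recipSum (suc a) c) (recipSum (suc (a ℕ.+ c)) d)))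
    (cong (λ z → recip a + recipSum (suc a) c + recipSum z d) (sym (ℕₚ.+-suc a c))))

recipSum-≥ : ∀ a c b → a ℕ.+ c ℕ.≤ suc b → c ×ℚ recip b ≤ recipSum a c
recipSum-≥ a zero    b _ = ℚₚ.≤-refl
recipSum-≥ a (suc c) b a+c<b = ℚₚ.+-mono-≤
  (recip-antimono (ℕₚ.≤-trans (ℕₚ.m≤m+n a c) (ℕ.s≤s⁻¹ sa+c≤sb)))
  (recipSum-≥ (suc a) c b sa+c≤sb)
  where
    sa+c≤sb : suc a ℕ.+ c ℕ.≤ suc b
    sa+c≤sb = subst (ℕ._≤ suc b) (ℕₚ.+-suc a c) a+c<b

recipSum-≤ : ∀ a c b → b ℕ.≤ a → recipSum a c ≤ c ×ℚ recip b
recipSum-≤ a zero    b _ = ℚₚ.≤-refl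
recipSum-≤ a (suc c) b b≤a = ℚₚ.+-mono-≤
  (recip-antimono b≤a) (recipSum-≤ (suc a) c b (ℕₚ.m≤n⇒m≤1+n b≤a))

recipSum-anti : ∀ a c → recipSum (suc a) c ≤ recipSum a c
recipSum-anti a zero    = ℚₚ.≤-refl
recipSum-anti a (suc c) =
  ℚₚ.+-mono-≤ (recip-antimono (ℕₚ.n≤1+n a)) (recipSum-anti (suc a) c)

-- Refining each interval into suc κ intervals increases the lower sum and
-- decreases the upper sum.

lower-refine : ∀ κ m c → recipSum m c ≤ recipSum (m ℕ.* suc κ) (c ℕ.* suc κ)
lower-refine κ m zero    = ℚₚ.≤-refl
lower-refine κ m (suc c) = subst (recip m + recipSum (suc m) c ≤_)
  (sym (recipSum-++ (m ℕ.* suc κ) (suc κ) (c ℕ.* suc κ)))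
  (ℚₚ.+-mono-≤
    (subst (_≤ recipSum (m ℕ.* suc κ) (suc κ)) (×ℚ-block m κ)
      (recipSum-≥ (m ℕ.* suc κ) (suc κ) (κ ℕ.+ m ℕ.* suc κ)
        (ℕₚ.≤-reflexive (ℕₚ.+-comm (m ℕ.* suc κ) (suc κ)))))
    (subst (λ z → recipSum (suc m) c ≤ recipSum z (c ℕ.* suc κ))
      (ℕₚ.+-comm (suc κ) (m ℕ.* suc κ)) (lower-refine κ (suc m) c)))

upper-refine : ∀ κ m c → recipSum (κ ℕ.+ m ℕ.* suc κ) (c ℕ.* suc κ) ≤ recipSum m c
upper-refine κ m zero    = ℚₚ.≤-refl
upper-refine κ m (suc c) = subst (_≤ recip m + recipSum (suc m) c)
  (sym (recipSum-++ (κ ℕ.+ m ℕ.* suc κ) (suc κ) (c ℕ.* suc κ)))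
  (ℚₚ.+-mono-≤
    (subst (recipSum (κ ℕ.+ m ℕ.* suc κ) (suc κ) ≤_) (×ℚ-block m κ)
      (recipSum-≤ (κ ℕ.+ m ℕ.* suc κ) (suc κ) (κ ℕ.+ m ℕ.* suc κ) ℕₚ.≤-refl))
    (subst (λ z → recipSum z (c ℕ.* suc κ) ≤ recipSum (suc m) c)
      eq (upper-refine κ (suc m) c)))
  where
    eq : κ ℕ.+ suc m ℕ.* suc κ ≡ (κ ℕ.+ m ℕ.* suc κ) ℕ.+ suc κ
    eq = trans (cong (κ ℕ.+_) (ℕₚ.+-comm (suc κ) (m ℕ.* suc κ)))
               (sym (ℕₚ.+-assoc κ (m ℕ.* suc κ) (suc κ)))

lowerSum≤upperSum : ∀ n μ κ → lowerSum n μ ≤ upperSum n κ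
lowerSum≤upperSum n μ κ = ℚₚ.≤-trans
  (lower-refine κ (suc μ) c)
  (ℚₚ.≤-trans (recipSum-anti (κ ℕ.+ μ ℕ.* suc κ) (c ℕ.* suc κ))
    (subst₂ (λ a b → recipSum a b ≤ upperSum n κ) eq₁ eq₂
      (upper-refine μ κ ((n ℕ.∸ 1) ℕ.* suc κ))))
  where
    c = (n ℕ.∸ 1) ℕ.* suc μ
    eq₁ : μ ℕ.+ κ ℕ.* suc μ ≡ κ ℕ.+ μ ℕ.* suc κ
    eq₁ = ℕₚ.suc-injective (ℕₚ.*-comm (suc κ) (suc μ))
    eq₂ : (n ℕ.∸ 1) ℕ.* suc κ ℕ.* suc μ ≡ c ℕ.* suc κ
    eq₂ = trans (ℕₚ.*-assoc (n ℕ.∸ 1) (suc κ) (suc μ))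
      (trans (cong ((n ℕ.∸ 1) ℕ.*_) (ℕₚ.*-comm (suc κ) (suc μ)))
        (sym (ℕₚ.*-assoc (n ℕ.∸ 1) (suc μ) (suc κ))))

recipSum-shift : ∀ a c → recipSum a c + recip (a ℕ.+ c) ≡ recip a + recipSum (suc a) c
recipSum-shift a c = trans
  (trans (cong (λ z → recipSum a c + z) (sym (ℚₚ.+-identityʳ (recip (a ℕ.+ c)))))
    (sym (recipSum-++ a c 1)))
  (cong (recipSum a) (ℕₚ.+-comm c 1))

upperSum≤lowerSum+recip : ∀ n μ → upperSum n μ ≤ lowerSum n μ + recip μ
upperSum≤lowerSum+recip n μ = subst₂ _≤_ (ℚₚ.+-identityʳ _)
  (trans (recipSum-shift μ c) (ℚₚ.+-comm (recip μ) (recipSum (suc μ) c)))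
  (ℚₚ.+-monoʳ-≤ (recipSum μ c) (ℚₚ.<⇒≤ (recip-pos (μ ℕ.+ c))))
  where c = (n ℕ.∸ 1) ℕ.* suc μ

log : (n : ℕ) .{{_ : NonZero n}} → ℝ
log n = record
  { L        = λ q → ∃ λ μ → q < lowerSum n μ
  ; U        = λ q → ∃ λ μ → upperSum n μ < q
  ; L-inhab  = lowerSum n 0 - 1ℚ , 0 , p-1<p (lowerSum n 0)
  ; U-inhab  = upperSum n 0 + 1ℚ , 0 , p<p+1 (upperSum n 0)
  ; L-closed = λ { p<q (μ , q<) → μ , ℚₚ.<-trans p<q q< }
  ; U-closed = λ { p<q (μ , <p) → μ , ℚₚ.<-trans <p p<q }
  ; L-open   = λ { (μ , p<) → let (q , p<q , q<) = ℚₚ.<-dense p< in q , p<q , μ , q< }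
  ; U-open   = λ { (μ , <q) → let (p , <p , p<q) = ℚₚ.<-dense <q in p , p<q , μ , <p }
  ; disjoint = λ { (μ , q<) (κ , <q) → ℚₚ.<-irrefl refl
                   (ℚₚ.<-≤-trans (ℚₚ.<-trans <q q<) (lowerSum≤upperSum n μ κ)) }
  ; located  = λ p<q → split p<q (recip-small (gap p<q))
  }
  where
    split : ∀ {p q} → p < q → (∃ λ μ → recip μ < q - p) →
            (∃ λ μ → p < lowerSum n μ) ⊎ (∃ λ μ → upperSum n μ < q)
    split {p} {q} p<q (μ , 1/m<q-p) with p ℚₚ.<? lowerSum n μ
    ... | yes p< = inj₁ (μ , p<)
    ... | no  p≮ = inj₂ (μ , ℚₚ.≤-<-trans (upperSum≤lowerSum+recip n μ)
            (subst (lowerSum n μ + recip μ <_)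
              (solve 2 (λ p q → p :+ (q :- p) := q) refl p q)
              (ℚₚ.+-mono-≤-< (ℚₚ.≮⇒≥ p≮) 1/m<q-p)))

{-# OPTIONS --safe #-}

-- Write k = k′ + 1, n = s + k and t = s + 1, and let a and b be the numbers of
-- remaining vertices on the two sides.  Deleting u lowers the total weight by
-- f(u) plus the number of unsaved neighbours, and f(u) exceeds |W|; hence a
-- removable state has total weight at least ab + a + b.  Weights opposite to a
-- side with a remaining vertices are at least a - s, so while a, b > t each
-- deletion satisfies |W| (a - s) ≤ k′, and before a or b reaches t at most
-- 2 k′ (1/2 + … + 1/k) weights are saved.  Comparing with the lower bound
-- ab + a + b at that moment gives t² ≤ 2 k′ (1/2 + … + 1/k) ≤ 2 n log n,
-- because 1/2 + … + 1/n is a lower Darboux sum of log n.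
module Submission where

open import Defs
open import Algebra.Properties.AbelianGroup using (⁻¹-involutive; ∙-cancelˡ)
open import Data.Bool.Base using (Bool; true; false; not; _∧_; _xor_; if_then_else_)
open import Data.Bool.Properties using (xor-comm; xor-same) renaming (_≟_ to _≟ᵇ_)
open import Data.Fin.Base using (Fin; zero; suc; punchIn; splitAt; _↑ʳ_)
open import Data.Fin.Subset using (Subset)
open import Data.Fin.Subset.Properties using (_∈?_)
open import Data.Integer.Base as ℤ using (ℤ; +_; 0ℤ; 1ℤ; +≤+; +<+)
import Data.Integer.Properties as ℤₚ
open import Algebra.Properties.CommutativeMonoid.Sum ℤₚ.+-0-commutativeMonoid
  using (sum; sum-remove; ∑-distrib-+; sum-cong-≗)
open import Data.Integer.Tactic.RingSolver using (solve-∀)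
open import Data.Nat.Base as ℕ using (ℕ; zero; suc; z≤n; s≤s; NonZero)
import Data.Nat.DivMod as ℕ/
import Data.Nat.Properties as ℕₚ
open import Data.Product.Base using (∃; _,_; proj₁; proj₂)
open import Data.Rational.Base as ℚ using (ℚ; 0ℚ; 1ℚ; ½; *<*)
import Data.Rational.Properties as ℚₚ
open import Data.Rational.Solver using (module +-*-Solver)
open import Data.Sum.Base as Sum using (_⊎_; inj₁; inj₂)
open import Function.Base using (_∘_; const)
open import Relation.Binary.PropositionalEquality
open import Relation.Nullary using (does; yes; no)
open import Relation.Nullary.Decidable using (¬?; dec-true; dec-false)

-- Integer slacks and indicator sums.

module Weights where
  open import Data.Integer.Base using (_+_; _*_; _-_; _≤_; _<_)

  -- Carries the linear arithmetic below: `d` is a sum of nonnegative slacks of the hypotheses, so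
  -- only a ring identity remains to be checked.
  ≤-by : ∀ {i j} d → 0ℤ ≤ d → i + d ≡ j → i ≤ j
  ≤-by {i} d 0≤d refl = ℤₚ.i≤i+j i d {{ℤ.nonNegative 0≤d}}

  slack : ∀ {i j} → i ≤ j → 0ℤ ≤ j - i
  slack = ℤₚ.i≤j⇒0≤j-i

  ⟦_⟧ : Bool → ℤ
  ⟦ b ⟧ = if b then 1ℤ else 0ℤ

  ⟦⟧-nonNeg : ∀ b → 0ℤ ≤ ⟦ b ⟧
  ⟦⟧-nonNeg true  = +≤+ z≤n
  ⟦⟧-nonNeg false = +≤+ z≤n

  card : ∀ {n} → Subset n → ℤ
  card W = sum (λ w → ⟦ does (w ∈? W) ⟧)

  sum-nonNeg : ∀ {n} (f : Fin n → ℤ) → (∀ x → 0ℤ ≤ f x) → 0ℤ ≤ sum f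
  sum-nonNeg {zero}  f 0≤f = ℤₚ.≤-refl
  sum-nonNeg {suc n} f 0≤f = ℤₚ.+-mono-≤ (0≤f zero) (sum-nonNeg (f ∘ suc) (0≤f ∘ suc))

  count*min≤sum : ∀ {n} (b : Fin n → Bool) (f : Fin n → ℤ) m →
    (∀ x → b x ≡ true → m ≤ f x) →
    sum (λ x → ⟦ b x ⟧) * m ≤ sum (λ x → if b x then f x else 0ℤ)
  count*min≤sum {zero}  b f m m≤f = ℤₚ.≤-refl
  count*min≤sum {suc n} b f m m≤f = subst (_≤ _)
    (sym (ℤₚ.*-distribʳ-+ m ⟦ b zero ⟧ (sum (λ x → ⟦ b (suc x) ⟧))))
    (ℤₚ.+-mono-≤ (head (b zero) (m≤f zero))
      (count*min≤sum (b ∘ suc) (f ∘ suc) m (m≤f ∘ suc)))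
    where
      head : ∀ b → (b ≡ true → m ≤ f zero) → ⟦ b ⟧ * m ≤ (if b then f zero else 0ℤ)
      head true  m≤f₀ = subst (_≤ f zero) (sym (ℤₚ.*-identityˡ m)) (m≤f₀ refl)
      head false _    = ℤₚ.≤-refl

  -- The effect of one deletion on the weights.

  module _ {n} (G : Graph (suc n)) (f : Fin (suc n) → ℤ) (u : Fin (suc n))
           (W : Subset (suc n)) where
    open Graph G

    saveWeights-≡ : ∀ x → let y = punchIn u x in
      saveWeights G f u W x ≡ f y - ⟦ does (u ~? y) ∧ not (does (y ∈? W)) ⟧
    saveWeights-≡ x with does (u ~? punchIn u x) ∧ not (does (punchIn u x ∈? W))
    ... | true  = refl
    ... | false = sym (ℤₚ.+-identityʳ _)

    saveWeights≤ : ∀ x → saveWeights G f u W x ≤ f (punchIn u x)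
    saveWeights≤ x = subst (_≤ f y) (sym (saveWeights-≡ x))
      (ℤₚ.i-j≤i (f y) ⟦ b ⟧ {{ℤ.nonNegative (⟦⟧-nonNeg b)}})
      where
        y = punchIn u x
        b = does (u ~? y) ∧ not (does (y ∈? W))

    -- Holds for every `W`, legal or not, since membership in `W` can only cancel a decrement. This
    -- is what preserves the slack invariant in `slack-delete`.
    saveWeights≥ : ∀ x → let y = punchIn u x in
      f y ≤ saveWeights G f u W x + ⟦ does (u ~? y) ⟧
    saveWeights≥ x = subst (λ z → f y ≤ z + ⟦ does (u ~? y) ⟧) (sym (saveWeights-≡ x))
      (bound (does (u ~? y)) (does (y ∈? W)))
      where
        y = punchIn u x
        bound : ∀ a w → f y ≤ f y - ⟦ a ∧ not w ⟧ + ⟦ a ⟧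
        bound a w = ≤-by (⟦ a ⟧ - ⟦ a ∧ not w ⟧) (slack (∧-≤ a w)) (ring (f y) _ _)
          where
            ∧-≤ : ∀ a w → ⟦ a ∧ not w ⟧ ≤ ⟦ a ⟧
            ∧-≤ true  true  = +≤+ z≤n
            ∧-≤ true  false = ℤₚ.≤-refl
            ∧-≤ false w     = ℤₚ.≤-refl
            ring : ∀ z i j → z + (j - i) ≡ z - i + j
            ring = solve-∀

    module _ (legal : Legal G f u W) where
      open Legal legal

      ∈⇒~ : ∀ y → does (y ∈? W) ≡ true → does (u ~? y) ≡ true
      ∈⇒~ y with y ∈? W
      ... | yes y∈W = λ _ → dec-true (u ~? y) (W⊆N y∈W)
      ... | no  _   = λ ()

      -- Each neighbour of `u` loses one unless it lies in `W`, and `W` contains only neighbours, so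
      -- the total falls by `f u` plus the degree of `u` minus `card W`.
      sum-saveWeights : sum (saveWeights G f u W) + f u + sum (λ y → ⟦ does (u ~? y) ⟧)
                        ≡ sum f + card W
      sum-saveWeights = begin
        sum (saveWeights G f u W) + f u + sum A
          ≡⟨ cong (λ z → z + f u + sum A) (sum-cong-≗ saveWeights-≡) ⟩
        sum (h ∘ punchIn u) + f u + sum A
          ≡⟨ cong (_+ sum A) (ℤₚ.+-comm _ (f u)) ⟩
        f u + sum (h ∘ punchIn u) + sum A
          ≡⟨ cong (λ z → z + sum (h ∘ punchIn u) + sum A) (sym hu≡fu) ⟩
        h u + sum (h ∘ punchIn u) + sum A
          ≡⟨ cong (_+ sum A) (sym (sum-remove {i = u} h)) ⟩
        sum h + sum A
          ≡⟨ sym (∑-distrib-+ h A) ⟩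
        sum (λ y → h y + A y)
          ≡⟨ sum-cong-≗ balance ⟩
        sum (λ y → f y + B y)
          ≡⟨ ∑-distrib-+ f B ⟩
        sum f + card W ∎
        where
          open ≡-Reasoning
          A B h : Fin (suc n) → ℤ
          A y = ⟦ does (u ~? y) ⟧
          B y = ⟦ does (y ∈? W) ⟧
          -- `h` extends the new weights to all vertices; having no loop, `u` keeps the value `f u`,
          -- so both sides can be compared vertex by vertex.
          h y = f y - ⟦ does (u ~? y) ∧ not (does (y ∈? W)) ⟧

          hu≡fu : h u ≡ f u
          hu≡fu rewrite dec-false (u ~? u) (~-irr refl) = ℤₚ.+-identityʳ (f u)

          balance : ∀ y → h y + A y ≡ f y + B y
          balance y = go (does (u ~? y)) (does (y ∈? W)) (∈⇒~ y)
            where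
              ring₁ : ∀ z → z - 0ℤ + 1ℤ ≡ z + 1ℤ
              ring₁ = solve-∀
              ring₂ : ∀ z → z - 1ℤ + 1ℤ ≡ z + 0ℤ
              ring₂ = solve-∀
              ring₃ : ∀ z → z - 0ℤ + 0ℤ ≡ z + 0ℤ
              ring₃ = solve-∀
              go : ∀ a w → (w ≡ true → a ≡ true) →
                   f y - ⟦ a ∧ not w ⟧ + ⟦ a ⟧ ≡ f y + ⟦ w ⟧
              go true  true  _ = ring₁ (f y)
              go true  false _ = ring₂ (f y)
              go false false _ = ring₃ (f y)
              go false true  e with () ← e refl

      -- Legality bounds the sum of the saved weights by `f u`, and each summand is at least `m`.
      -- Taking `m` = 1 gives |W| < f(u); larger `m` limits how many neighbours can be saved.
      card*min<f : ∀ m → (∀ w → does (u ~? w) ≡ true → m ≤ f w) → card W * m < f u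
      card*min<f m m≤f = ℤₚ.≤-<-trans
        (count*min≤sum (λ w → does (w ∈? W)) f m (λ w w∈W → m≤f w (∈⇒~ w w∈W))) saves

  -- Two-coloured complete bipartite graphs and the lower bound on the total weight.

  -- The colouring is arbitrary, so the property passes to vertex-deleted graphs by restriction,
  -- whereas `K m n` fixes the order of its vertices.
  CompleteBipartite : ∀ {n} → Graph n → (Fin n → Bool) → Set
  CompleteBipartite G c = ∀ x y → does (x ~? y) ≡ c x xor c y
    where open Graph G

  -- In a complete bipartite graph, the degree of every vertex of colour β.
  opposite : ∀ {n} → (Fin n → Bool) → Bool → ℤ
  opposite c β = sum (λ y → ⟦ β xor c y ⟧)

  module _ {n} (c : Fin (suc n) → Bool) (u : Fin (suc n)) where

    opposite-delete : ∀ β →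
      opposite c β ≡ ⟦ β xor c u ⟧ + opposite (c ∘ punchIn u) β
    opposite-delete β = sum-remove {i = u} (λ y → ⟦ β xor c y ⟧)

    opposite-delete-same : ∀ β → c u ≡ β → opposite c β ≡ opposite (c ∘ punchIn u) β
    opposite-delete-same β refl = trans (opposite-delete β)
      (trans (cong (λ b → ⟦ b ⟧ + opposite (c ∘ punchIn u) β) (xor-same β))
        (ℤₚ.+-identityˡ (opposite (c ∘ punchIn u) β)))

    opposite-delete-other : ∀ β → c u ≡ not β →
      opposite c β ≡ 1ℤ + opposite (c ∘ punchIn u) β
    opposite-delete-other β cu = trans (opposite-delete β)
      (cong (λ b → ⟦ b ⟧ + opposite (c ∘ punchIn u) β)
        (trans (cong (β xor_) cu) (xor-not β)))
      where
        xor-not : ∀ β → β xor not β ≡ true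
        xor-not true  = refl
        xor-not false = refl

  delete-weight : ∀ {n} {G : Graph (suc n)} {f u W} (c : Fin (suc n) → Bool) →
    CompleteBipartite G c → Legal G f u W → ∀ {β} → c u ≡ β →
    sum (saveWeights G f u W) + f u + opposite c β ≡ sum f + card W
  delete-weight {G = G} {f} {u} {W} c bip legal refl = trans
    (cong (λ z → sum (saveWeights G f u W) + f u + z)
      (sum-cong-≗ (λ y → cong ⟦_⟧ (sym (bip u y)))))
    (sum-saveWeights G f u W legal)

  -- The left side counts edges plus vertices. A deletion lowers this count by deg(u) + 1, and it
  -- lowers the weight by f(u) + deg(u) - |W|, which is at least as much because f(u) > |W|.
  order+size≤weight : ∀ {n} {G : Graph n} {f} (c : Fin n → Bool) →
    CompleteBipartite G c → (∀ x → 1ℤ ≤ f x) → Removable G f →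
    opposite c true * opposite c false + opposite c true + opposite c false ≤ sum f
  order+size≤weight c bip 1≤f done = ℤₚ.≤-refl
  order+size≤weight {G = G} {f} c bip 1≤f (delSave u W legal rem) =
    step (c u) refl (order+size≤weight (c ∘ punchIn u) (λ x y → bip _ _) positive rem)
    where
      open Legal legal
      c′ = c ∘ punchIn u
      S′ = sum (saveWeights G f u W)

      saved<f : 0ℤ ≤ f u - (1ℤ + card W)
      saved<f = slack (ℤₚ.i<j⇒suc[i]≤j (subst (_< f u) (ℤₚ.*-identityʳ (card W))
        (card*min<f G f u W legal 1ℤ (λ w _ → 1≤f w))))

      -- `d` is the degree of `u`, and `e` is the number of vertices left in its own class.
      arith : ∀ {d S w F} e S′ → S′ + F + d ≡ S + w →
        0ℤ ≤ F - (1ℤ + w) → d * e + d + e ≤ S′ → d * (1ℤ + e) + d + (1ℤ + e) ≤ S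
      arith {d} {S} {w} {F} e S′ balance 0≤F-w ih =
        ≤-by _ (ℤₚ.+-mono-≤ 0≤F-w (slack ih))
          (trans (ring d e S′ F w) (trans (cong (_- w) balance) (ring′ S w)))
        where
          ring : ∀ d e S′ F w → d * (1ℤ + e) + d + (1ℤ + e) +
                   ((F - (1ℤ + w)) + (S′ - (d * e + d + e))) ≡ S′ + F + d - w
          ring = solve-∀
          ring′ : ∀ S w → S + w - w ≡ S
          ring′ = solve-∀

      flip : ∀ d e → d * e + d + e ≡ e * d + e + d
      flip = solve-∀

      D′ = opposite c′

      balance : ∀ β → c u ≡ β → S′ + f u + D′ β ≡ sum f + card W
      balance β cu = trans (cong (λ z → S′ + f u + z) (sym (opposite-delete-same c u β cu)))
        (delete-weight c bip legal cu)

      step : ∀ γ → c u ≡ γ →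
             D′ true * D′ false + D′ true + D′ false ≤ S′ →
             opposite c true * opposite c false + opposite c true + opposite c false ≤ sum f
      step true cu ih = subst₂ (λ d e → d * e + d + e ≤ sum f)
        (sym (opposite-delete-same c u true cu)) (sym (opposite-delete-other c u false cu))
        (arith (D′ false) S′ (balance true cu) saved<f ih)
      step false cu ih = subst₂ (λ d e → d * e + d + e ≤ sum f)
        (sym (opposite-delete-other c u true cu)) (sym (opposite-delete-same c u false cu))
        (subst (_≤ sum f) (flip (D′ false) (1ℤ + D′ true))
          (arith (D′ true) S′ (balance false cu) saved<f
            (subst (_≤ S′) (flip (D′ true) (D′ false)) ih)))

  -- Counting the weights saved while both classes are large.

  -- Σ_{i=2}^{p+1} ⌊m/i⌋
  floorSum : ℕ → ℕ → ℕ
  floorSum m zero    = 0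
  floorSum m (suc p) = m ℕ./ suc (suc p) ℕ.+ floorSum m p

  -- The strict inequality absorbs the successor in the bound on `f`, so the quotient is taken of k
  -- - 1 rather than k.
  quotient-bound : ∀ {w f} m d → 0ℤ ≤ w → w * + suc d < f → f ≤ + suc m →
    w ≤ + (m ℕ./ suc d)
  quotient-bound {+ w} m d _ w*d<f f≤m with ℤₚ.<-≤-trans w*d<f f≤m
  ... | w*d<m rewrite sym (ℤₚ.pos-* w (suc d)) with +<+ (s≤s w*d≤m) ← w*d<m =
    +≤+ (subst (ℕ._≤ m ℕ./ suc d) (ℕ/.m*n/n≡m w (suc d)) (ℕ/./-monoˡ-≤ (suc d) w*d≤m))

  other-colour : ∀ {n} {G : Graph n} (c : Fin n → Bool) → CompleteBipartite G c →
    ∀ {u w β} → c u ≡ β → does (Graph._~?_ G u w) ≡ true → c w ≡ not β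
  other-colour c bip {u} {w} refl u~w = go (c u) (c w) (trans (sym (bip u w)) u~w)
    where
      go : ∀ a b → a xor b ≡ true → b ≡ not a
      go true  false _ = refl
      go false true  _ = refl

  module _ (s k′ : ℕ) where

    t : ℤ
    t = + suc s

    -- Deleting a neighbour of `x` shrinks the class opposite `x` by one and lowers its weight by at
    -- most one; deleting a non-neighbour changes neither.
    slack-delete : ∀ {n} {G : Graph (suc n)} {f} (c : Fin (suc n) → Bool) u W →
      CompleteBipartite G c → (∀ x → opposite c (c x) ≤ f x + + s) →
      let c′ = c ∘ punchIn u in
      ∀ x → opposite c′ (c′ x) ≤ saveWeights G f u W x + + s
    slack-delete {G = G} {f} c u W bip inv x =
      ≤-by _ (ℤₚ.+-mono-≤ (slack (inv y)) (slack (saveWeights≥ G f u W x)))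
        (trans (cong (λ z → D + (f y + + s - z + (f′ + ⟦ u~y ⟧ - f y))) opposite≡)
          (ring D (f y) (+ s) ⟦ u~y ⟧ f′))
      where
        c′ = c ∘ punchIn u
        y = punchIn u x
        f′ = saveWeights G f u W x
        u~y = does (Graph._~?_ G u y)
        D = opposite c′ (c y)
        opposite≡ : opposite c (c y) ≡ ⟦ u~y ⟧ + D
        opposite≡ = trans (opposite-delete c u (c y))
          (cong (λ b → ⟦ b ⟧ + D) (trans (xor-comm (c y) (c u)) (sym (bip u y))))
        ring : ∀ o f s d f′ → o + (f + s - (d + o) + (f′ + d - f)) ≡ f′ + s
        ring = solve-∀

    -- S is the total weight when t + q vertices have colour true and t + p have
    -- colour false.  The floorSum terms bound the number of weights that can still
    -- be saved before one of the classes shrinks to t vertices.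
    record PotentialBound (p q : ℕ) (S : ℤ) : Set where
      constructor mk
      field bound : t * t + (t + + p) * (1ℤ + + q) + (t + + q) * (1ℤ + + p)
                    ≤ S + (+ floorSum k′ p + + floorSum k′ q)

    PotentialBound-sym : ∀ p q {S} → PotentialBound p q S → PotentialBound q p S
    PotentialBound-sym p q {S} (mk b) = mk (subst₂ _≤_
      (ring (t * t) ((t + + p) * (1ℤ + + q)) ((t + + q) * (1ℤ + + p)))
      (cong (λ z → S + z) (ℤₚ.+-comm (+ floorSum k′ p) (+ floorSum k′ q))) b)
      where
        ring : ∀ a b c → a + b + c ≡ a + c + b
        ring = solve-∀

    -- At p = 0 the left side of the bound is exactly ab + a + b with a = t and b = t + q, so the
    -- lower bound on the total weight is enough.
    PotentialBound-zero : ∀ q {S} →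
      (t + + 0) * (t + + q) + (t + + 0) + (t + + q) ≤ S → PotentialBound 0 q S
    PotentialBound-zero q {S} ab+a+b≤S = mk (≤-by _
      (ℤₚ.+-mono-≤ (slack ab+a+b≤S) (+≤+ (z≤n {floorSum k′ q})))
      (ring t (+ q) S (+ floorSum k′ q)))
      where
        ring : ∀ t q S Q →
          t * t + (t + 0ℤ) * (1ℤ + q) + (t + q) * (1ℤ + 0ℤ) +
            (S - ((t + 0ℤ) * (t + q) + (t + 0ℤ) + (t + q)) + Q)
          ≡ S + (0ℤ + Q)
        ring = solve-∀

    -- Describes deleting a vertex of degree `t + p` and weight `F`. By the slack hypothesis `F` is
    -- at least p + 1, and p + 1 plus the degree is the growth of the left side from q to q + 1. The
    -- saved weights are paid for by the new term of `floorSum k′`.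
    PotentialBound-step : ∀ p q {S S′ F w} → S′ + F + (t + + p) ≡ S + w →
      t + + p ≤ F + + s → w ≤ + (k′ ℕ./ suc (suc q)) →
      PotentialBound p q S′ → PotentialBound p (suc q) S
    PotentialBound-step p q {S} {S′} {F} {w} balance inv w≤ (mk ih) = mk (≤-by _
      (ℤₚ.+-mono-≤ (ℤₚ.+-mono-≤ (slack inv) (slack w≤)) (slack ih))
      (trans (ring (+ s) (+ p) (+ q) S′ F w i P Q)
        (trans (cong (λ z → z - w + (P + (i + Q))) balance)
          (ring′ S w _))))
      where
        i = + (k′ ℕ./ suc (suc q))
        P = + floorSum k′ p
        Q = + floorSum k′ q
        ring : ∀ s p q S′ F w i P Q → let t = 1ℤ + s in
          t * t + (t + p) * (1ℤ + (1ℤ + q)) + (t + (1ℤ + q)) * (1ℤ + p) +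
            ((F + s - (t + p)) + (i - w) +
             (S′ + (P + Q) - (t * t + (t + p) * (1ℤ + q) + (t + q) * (1ℤ + p))))
          ≡ S′ + F + (t + p) - w + (P + (i + Q))
        ring = solve-∀
        ring′ : ∀ S w z → S + w - w + z ≡ S + z
        ring′ = solve-∀

    module _ {n} {f : Fin n → ℤ} (c : Fin n → Bool) p q
             (true≡ : opposite c true ≡ t + + p) (false≡ : opposite c false ≡ t + + q)
             (inv : ∀ x → opposite c (c x) ≤ f x + + s) where

      excess : ∀ {β r} → opposite c β ≡ t + + r → ∀ x → c x ≡ β → + suc r ≤ f x
      excess {β} {r} eq x cx = ≤-by _
        (slack (subst (_≤ f x + + s) (trans (cong (opposite c) cx) eq) (inv x)))
        (ring (+ s) (+ r) (f x))
        where
          ring : ∀ s r z → 1ℤ + r + (z + s - (1ℤ + s + r)) ≡ z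
          ring = solve-∀

      1≤f : ∀ x → 1ℤ ≤ f x
      1≤f x = positive (c x) refl
        where
          positive : ∀ β → c x ≡ β → 1ℤ ≤ f x
          positive true  cx = ℤₚ.≤-trans (+≤+ (s≤s z≤n)) (excess true≡ x cx)
          positive false cx = ℤₚ.≤-trans (+≤+ (s≤s z≤n)) (excess false≡ x cx)

      weight≥ : {G : Graph n} → CompleteBipartite G c → Removable G f →
        (t + + p) * (t + + q) + (t + + p) + (t + + q) ≤ sum f
      weight≥ bip rem = subst₂ (λ a b → a * b + a + b ≤ sum f) true≡ false≡
        (order+size≤weight c bip 1≤f rem)

    potential-step : ∀ {n} {G : Graph (suc n)} {f u W} (c : Fin (suc n) → Bool) p q →
      CompleteBipartite G c →
      opposite c true ≡ t + + suc p → opposite c false ≡ t + + suc q →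
      (∀ x → opposite c (c x) ≤ f x + + s) → (∀ x → f x ≤ + suc k′) →
      Legal G f u W →
      let c′ = c ∘ punchIn u in
      (∀ p q → opposite c′ true ≡ t + + p → opposite c′ false ≡ t + + q →
        PotentialBound p q (sum (saveWeights G f u W))) →
      PotentialBound (suc p) (suc q) (sum f)
    potential-step {G = G} {f} {u} {W} c p q bip true≡ false≡ inv f≤k legal ih = step (c u) refl
      where
        c′ = c ∘ punchIn u
        S′ = sum (saveWeights G f u W)
        0≤card : 0ℤ ≤ card W
        0≤card = sum-nonNeg _ (λ w → ⟦⟧-nonNeg (does (w ∈? W)))

        balance : ∀ {β d} → c u ≡ β → opposite c β ≡ d → S′ + f u + d ≡ sum f + card W
        balance cu refl = delete-weight c bip legal cu

        invᵤ : ∀ {β d} → c u ≡ β → opposite c β ≡ d → d ≤ f u + + s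
        invᵤ refl refl = inv u

        -- The neighbours of `u` face a class of `t + suc r` vertices, so each has weight at least r
        -- + 2, while `f u` is at most k′ + 1.
        card≤ : ∀ {β r} → c u ≡ β → opposite c (not β) ≡ t + + suc r →
                card W ≤ + (k′ ℕ./ suc (suc r))
        card≤ {r = r} cu eq = quotient-bound k′ (suc r) 0≤card
          (card*min<f G f u W legal (+ suc (suc r))
            (λ w u~w → excess {f = f} c (suc p) (suc q) true≡ false≡ inv eq w
              (other-colour {G = G} c bip cu u~w)))
          (f≤k u)

        same : ∀ {β d} → c u ≡ β → opposite c β ≡ d → opposite c′ β ≡ d
        same {β} cu eq = trans (sym (opposite-delete-same c u β cu)) eq

        other : ∀ {β r} → c u ≡ not β → opposite c β ≡ t + + suc r → opposite c′ β ≡ t + + r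
        other {β} {r} cu eq = ∙-cancelˡ ℤₚ.+-0-abelianGroup 1ℤ (opposite c′ β) (t + + r)
          (trans (sym (opposite-delete-other c u β cu)) (trans eq (ring t (+ r))))
          where
            ring : ∀ t r → t + (1ℤ + r) ≡ 1ℤ + (t + r)
            ring = solve-∀

        step : ∀ β → c u ≡ β → PotentialBound (suc p) (suc q) (sum f)
        step true  cu = PotentialBound-step (suc p) q (balance cu true≡) (invᵤ cu true≡)
          (card≤ cu false≡) (ih (suc p) q (same cu true≡) (other cu false≡))
        step false cu = PotentialBound-sym (suc q) (suc p)
          (PotentialBound-step (suc q) p (balance cu false≡) (invᵤ cu false≡) (card≤ cu true≡)
            (PotentialBound-sym p (suc q) (ih p (suc q) (other cu true≡) (same cu false≡))))

    -- Follows the deletions until one class has exactly `t` vertices, where the lower bound on the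
    -- total weight applies. The upper bound on `f` persists because weights never increase.
    potential-bound : ∀ {n} {G : Graph n} {f} (c : Fin n → Bool) p q →
      CompleteBipartite G c → opposite c true ≡ t + + p → opposite c false ≡ t + + q →
      (∀ x → opposite c (c x) ≤ f x + + s) → (∀ x → f x ≤ + suc k′) →
      Removable G f → PotentialBound p q (sum f)
    potential-bound c zero q bip true≡ false≡ inv f≤k rem =
      PotentialBound-zero q (weight≥ c 0 q true≡ false≡ inv bip rem)
    potential-bound {f = f} c (suc p) zero bip true≡ false≡ inv f≤k rem =
      PotentialBound-sym 0 (suc p) (PotentialBound-zero (suc p)
        (subst (_≤ sum f) (flip (t + + suc p) (t + + 0))
          (weight≥ c (suc p) 0 true≡ false≡ inv bip rem)))
      where
        flip : ∀ a b → a * b + a + b ≡ b * a + b + a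
        flip = solve-∀
    -- In the empty graph `opposite` is 0, which is never `t + suc p`.
    potential-bound c (suc p) (suc q) bip () false≡ inv f≤k done
    potential-bound c (suc p) (suc q) bip true≡ false≡ inv f≤k (delSave {G = G} {f} u W legal rem) =
      potential-step {G = G} {f} {u} {W} c p q bip true≡ false≡ inv f≤k legal ih
      where
        ih : ∀ p q → opposite (c ∘ punchIn u) true ≡ t + + p →
             opposite (c ∘ punchIn u) false ≡ t + + q →
             PotentialBound p q (sum (saveWeights G f u W))
        ih p′ q′ true≡′ false≡′ = potential-bound {G = deleteVertex G u} {saveWeights G f u W}
          (c ∘ punchIn u) p′ q′ (λ x y → bip (punchIn u x) (punchIn u y)) true≡′ false≡′
          (slack-delete {G = G} {f} c u W bip inv)
          (λ x → ℤₚ.≤-trans (saveWeights≤ G f u W x) (f≤k (punchIn u x))) rem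

  -- Specialisation to the balanced complete bipartite graph.

  K-completeBipartite : ∀ m n → CompleteBipartite (K m n) (leftPart m)
  K-completeBipartite m n x y = ≢-xor (leftPart m x) (leftPart m y)
    where
      ≢-xor : ∀ a b → does (¬? (a ≟ᵇ b)) ≡ a xor b
      ≢-xor true  true  = refl
      ≢-xor true  false = refl
      ≢-xor false true  = refl
      ≢-xor false false = refl

  sum-const : ∀ n z → sum {n} (const z) ≡ + n * z
  sum-const zero    z = sym (ℤₚ.*-zeroˡ z)
  sum-const (suc n) z = trans (cong (λ s → z + s) (sum-const n z)) (sym (ℤₚ.suc-* (+ n) z))

  leftPart-suc : ∀ m {n} (x : Fin (m ℕ.+ n)) → leftPart (suc m) (suc x) ≡ leftPart m x
  leftPart-suc m x with splitAt m x
  ... | inj₁ _ = refl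
  ... | inj₂ _ = refl

  sum-leftPart : ∀ m n (g : Bool → ℤ) →
    sum {m ℕ.+ n} (λ x → g (leftPart m x)) ≡ + m * g true + + n * g false
  sum-leftPart zero    n g = trans (sum-const n (g false))
    (sym (trans (cong (_+ + n * g false) (ℤₚ.*-zeroˡ (g true))) (ℤₚ.+-identityˡ (+ n * g false))))
  sum-leftPart (suc m) n g = trans
    (cong (λ z → g true + z)
      (trans (sum-cong-≗ (λ x → cong g (leftPart-suc m x))) (sum-leftPart m n g)))
    (ring (g true) (g false) (+ m) (+ n))
    where
      ring : ∀ a b m n → a + (m * a + n * b) ≡ (1ℤ + m) * a + n * b
      ring = solve-∀

  opposite-K : ∀ n β → opposite (leftPart n {n}) β ≡ + n
  opposite-K n β = trans (sum-leftPart n n (λ b → ⟦ β xor b ⟧)) (go β)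
    where
      ring₁ : ∀ n → n * 0ℤ + n * 1ℤ ≡ n
      ring₁ = solve-∀
      ring₂ : ∀ n → n * 1ℤ + n * 0ℤ ≡ n
      ring₂ = solve-∀
      go : ∀ β → + n * ⟦ β xor true ⟧ + + n * ⟦ β xor false ⟧ ≡ + n
      go true  = ring₁ (+ n)
      go false = ring₂ (+ n)

  -- Start from p = q = k′, where t + k′ = n. The two products in the potential bound both equal nk
  -- and cancel the initial total weight 2nk, which leaves only t² against the saved weights.
  K-removable⇒square≤ : ∀ s k′ {n} → suc k′ ℕ.+ s ≡ n → ((+ suc k′) -removable) (K n n) →
    suc s ℕ.* suc s ℕ.≤ floorSum k′ k′ ℕ.+ floorSum k′ k′
  K-removable⇒square≤ s k′ refl rem = ℤₚ.drop‿+≤+ (subst (_≤ + (F ℕ.+ F))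
    (sym (ℤₚ.pos-* (suc s) (suc s)))
    (≤-by _ (slack (PotentialBound.bound concl))
      (trans (cong (λ z → t² + (z + (+ F + + F) - B)) (sum-leftPart n n (const (+ suc k′))))
        (ring (+ s) (+ k′) (+ F)))))
    where
      n = suc (k′ ℕ.+ s)
      F = floorSum k′ k′
      t² = + suc s * + suc s
      B = t² + (+ suc s + + k′) * (1ℤ + + k′) + (+ suc s + + k′) * (1ℤ + + k′)

      opp : ∀ β → opposite (leftPart n {n}) β ≡ + suc s + + k′
      opp β = trans (opposite-K n β) (cong (λ z → + suc z) (ℕₚ.+-comm k′ s))

      inv : ∀ x → opposite (leftPart n {n}) (leftPart n {n} x) ≤ + suc k′ + + s
      inv x = ℤₚ.≤-reflexive (opposite-K n (leftPart n {n} x))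

      concl = potential-bound s k′ (leftPart n) k′ k′ (K-completeBipartite n n)
        (opp true) (opp false) inv (λ _ → ℤₚ.≤-refl) rem

      ring : ∀ s k F → let t = 1ℤ + s ; n = 1ℤ + (k + s) in
        t * t + (n * (1ℤ + k) + n * (1ℤ + k) + (F + F)
          - (t * t + (t + k) * (1ℤ + k) + (t + k) * (1ℤ + k))) ≡ F + F
      ring = solve-∀

  K-removable⇒positive : ∀ n .{{_ : NonZero n}} k → (k -removable) (K n n) → 1ℤ ≤ k
  K-removable⇒positive (suc n) k (delSave u W legal _) =
    ℤₚ.≤-trans (Legal.positive legal x) (saveWeights≤ (K (suc n) (suc n)) (const k) u W x)
    -- Any vertex surviving the first deletion would do; this one exists because the right class is
    -- nonempty.
    where x = n ↑ʳ zero

open Weights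

-- Rational multiples and harmonic sums.

×ℚ-+ : ∀ m n p → (m ℕ.+ n) ×ℚ p ≡ m ×ℚ p ℚ.+ n ×ℚ p
×ℚ-+ zero    n p = sym (ℚₚ.+-identityˡ (n ×ℚ p))
×ℚ-+ (suc m) n p = trans (cong (λ z → p ℚ.+ z) (×ℚ-+ m n p)) (sym (ℚₚ.+-assoc p (m ×ℚ p) (n ×ℚ p)))

×ℚ-* : ∀ m n p → (m ℕ.* n) ×ℚ p ≡ m ×ℚ (n ×ℚ p)
×ℚ-* zero    n p = refl
×ℚ-* (suc m) n p = trans (×ℚ-+ n (m ℕ.* n) p) (cong (λ z → n ×ℚ p ℚ.+ z) (×ℚ-* m n p))

×ℚ-distrib : ∀ n p q → n ×ℚ (p ℚ.+ q) ≡ n ×ℚ p ℚ.+ n ×ℚ q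
×ℚ-distrib zero    p q = refl
×ℚ-distrib (suc n) p q = trans (cong (λ z → p ℚ.+ q ℚ.+ z) (×ℚ-distrib n p q))
  (solve 4 (λ p q a b → p :+ q :+ (a :+ b) := p :+ a :+ (q :+ b)) refl p q (n ×ℚ p) (n ×ℚ q))
  where open +-*-Solver

×ℚ-nonNeg : ∀ n {p} → 0ℚ ℚ.≤ p → 0ℚ ℚ.≤ n ×ℚ p
×ℚ-nonNeg zero    0≤p = ℚₚ.≤-refl
×ℚ-nonNeg (suc n) 0≤p = ℚₚ.+-mono-≤ 0≤p (×ℚ-nonNeg n 0≤p)

×ℚ-mono-≤ : ∀ {m n p q} → m ℕ.≤ n → p ℚ.≤ q → 0ℚ ℚ.≤ q → m ×ℚ p ℚ.≤ n ×ℚ q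
×ℚ-mono-≤ {n = n} z≤n       p≤q 0≤q = ×ℚ-nonNeg n 0≤q
×ℚ-mono-≤         (s≤s m≤n) p≤q 0≤q = ℚₚ.+-mono-≤ p≤q (×ℚ-mono-≤ m≤n p≤q 0≤q)

×ℚ-monoʳ-< : ∀ n .{{_ : NonZero n}} {p q} → p ℚ.< q → n ×ℚ p ℚ.< n ×ℚ q
×ℚ-monoʳ-< (suc n) p<q = ℚₚ.+-mono-<-≤ p<q (×ℚ-monoʳ-≤ n)
  where
    ×ℚ-monoʳ-≤ : ∀ n → n ×ℚ _ ℚ.≤ n ×ℚ _
    ×ℚ-monoʳ-≤ zero    = ℚₚ.≤-refl
    ×ℚ-monoʳ-≤ (suc n) = ℚₚ.+-mono-≤ (ℚₚ.<⇒≤ p<q) (×ℚ-monoʳ-≤ n)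

0≤1 : 0ℚ ℚ.≤ 1ℚ
0≤1 = ℚₚ.<⇒≤ 0<1

×ℚ-recip-self : ∀ d → suc d ×ℚ recip d ≡ 1ℚ
×ℚ-recip-self d = subst (λ z → suc d ×ℚ recip z ≡ 1ℚ) (ℕₚ.+-identityʳ d) (×ℚ-block 0 d)

-- Each unit of the quotient is d + 1 copies of 1/(d+1), and at most m copies are used in all.
quotient≤ : ∀ m d → (m ℕ./ suc d) ×ℚ 1ℚ ℚ.≤ m ×ℚ recip d
quotient≤ m d = subst (ℚ._≤ m ×ℚ recip d)
  (trans (×ℚ-* (m ℕ./ suc d) (suc d) (recip d)) (cong (λ z → (m ℕ./ suc d) ×ℚ z) (×ℚ-recip-self d)))
  (×ℚ-mono-≤ (ℕ/.m/n*n≤m m (suc d)) ℚₚ.≤-refl (ℚₚ.<⇒≤ (recip-pos d)))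

-- `recipSum` unfolds at its first term but `floorSum` at its last; this aligns the two recursions.
recipSum-suc : ∀ a c → recipSum a (suc c) ≡ recip (a ℕ.+ c) ℚ.+ recipSum a c
recipSum-suc a c = sym (trans (ℚₚ.+-comm (recip (a ℕ.+ c)) (recipSum a c)) (recipSum-shift a c))

recipSum-nonNeg : ∀ a c → 0ℚ ℚ.≤ recipSum a c
recipSum-nonNeg a zero    = ℚₚ.≤-refl
recipSum-nonNeg a (suc c) = ℚₚ.+-mono-≤ (ℚₚ.<⇒≤ (recip-pos a)) (recipSum-nonNeg (suc a) c)

recipSum-monoʳ : ∀ a {c d} → c ℕ.≤ d → recipSum a c ℚ.≤ recipSum a d
recipSum-monoʳ a {d = d} z≤n = recipSum-nonNeg a d
recipSum-monoʳ a (s≤s c≤d)   = ℚₚ.+-monoʳ-≤ (recip a) (recipSum-monoʳ (suc a) c≤d)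

floorSum≤ : ∀ m p → floorSum m p ×ℚ 1ℚ ℚ.≤ m ×ℚ recipSum 1 p
floorSum≤ m zero    = ×ℚ-nonNeg m ℚₚ.≤-refl
floorSum≤ m (suc p) = subst₂ ℚ._≤_
  (sym (×ℚ-+ (m ℕ./ suc (suc p)) (floorSum m p) 1ℚ))
  (trans (sym (×ℚ-distrib m (recip (suc p)) (recipSum 1 p))) (cong (m ×ℚ_) (sym (recipSum-suc 1 p))))
  (ℚₚ.+-mono-≤ (quotient≤ m (suc p)) (floorSum≤ m p))

-- Rationals below the square root.

-- Every sum of cuts demands a strict inequality, so density supplies a rational strictly between q
-- - c and the remaining multiple of c to pass to the recursive call.
·-L : ∀ n {x c q} → ℝ.L x c → q ℚ.< n ×ℚ c → ℝ.L (n · x) q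
·-L zero    Lc q<0 = q<0
·-L (suc n) {x} {c} {q} Lc q<c+nc = c , proj₁ mid , Lc , ·-L n Lc (proj₂ (proj₂ mid)) ,
  subst (ℚ._< c ℚ.+ proj₁ mid) (ring₁ c q) (ℚₚ.+-monoʳ-< c (proj₁ (proj₂ mid)))
  where
    open +-*-Solver
    ring₁ : ∀ c q → c ℚ.+ (q ℚ.- c) ≡ q
    ring₁ = solve 2 (λ c q → c :+ (q :- c) := q) refl
    mid = ℚₚ.<-dense {q ℚ.- c} {n ×ℚ c} (subst (q ℚ.- c ℚ.<_)
      (solve 2 (λ c z → c :+ z :- c := z) refl c (n ×ℚ c)) (ℚₚ.+-monoˡ-< (ℚ.- c) q<c+nc))

-- Adding recip 3 = ¼ leaves room for the strict inequality needed later.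
log+1-L : ∀ n .{{_ : NonZero n}} → ℝ.L (log n +ℝ fromℤ (+ 1)) (lowerSum n 0 ℚ.+ recip 3)
log+1-L n = ls ℚ.- recip 3 , ½ ℚ.+ recip 3 ,
    (0 , by-gap (recip 3) (recip-pos 3)
      (solve 1 (λ x → x :- con (recip 3) :+ con (recip 3) := x) refl ls)) ,
    by-gap (recip 3) (recip-pos 3) refl ,
    by-gap (recip 3) (recip-pos 3)
      (solve 1 (λ x → x :+ con (recip 3) :+ con (recip 3)
                    := x :- con (recip 3) :+ (con ½ :+ con (recip 3))) refl ls)
  where
    open +-*-Solver
    ls = lowerSum n 0

sq-×ℚ : ∀ n → (n ×ℚ 1ℚ) ℚ.* (n ×ℚ 1ℚ) ≡ (n ℕ.* n) ×ℚ 1ℚ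
sq-×ℚ n = trans (×ℚ-assoc n 1ℚ (n ×ℚ 1ℚ))
  (trans (cong (n ×ℚ_) (ℚₚ.*-identityˡ (n ×ℚ 1ℚ))) (sym (×ℚ-* n n 1ℚ)))

-- `lowerSum n 0` has mesh 1 and equals 1/2 + ... + 1/n. As m + 1 is at most n, it dominates the
-- harmonic sum that bounds `floorSum m m`.
√-L : ∀ n .{{_ : NonZero n}} t m → m ℕ.≤ n ℕ.∸ 1 →
  t ℕ.* t ℕ.≤ floorSum m m ℕ.+ floorSum m m →
  ℝ.L (√ ((2 ℕ.* n) · (log n +ℝ fromℤ (+ 1)))) (t ×ℚ 1ℚ)
√-L n t m m≤n-1 t²≤2F = inj₂ (·-L (2 ℕ.* n) (log+1-L n) t²<)
  where
    ls = lowerSum n 0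
    F = floorSum m m
    F≤nls : F ×ℚ 1ℚ ℚ.≤ n ×ℚ ls
    F≤nls = ℚₚ.≤-trans (floorSum≤ m m) (×ℚ-mono-≤ (ℕₚ.≤-trans m≤n-1 (ℕₚ.m∸n≤m n 1))
      (recipSum-monoʳ 1 (subst (m ℕ.≤_) (sym (ℕₚ.*-identityʳ (n ℕ.∸ 1))) m≤n-1))
      (recipSum-nonNeg 1 ((n ℕ.∸ 1) ℕ.* 1)))
    t²≤2nls : (t ℕ.* t) ×ℚ 1ℚ ℚ.≤ (2 ℕ.* n) ×ℚ ls
    t²≤2nls = ℚₚ.≤-trans (×ℚ-mono-≤ t²≤2F ℚₚ.≤-refl 0≤1)
      (subst₂ ℚ._≤_ (sym (×ℚ-+ F F 1ℚ))
        (trans (sym (×ℚ-+ n n ls)) (cong (λ z → (n ℕ.+ z) ×ℚ ls) (sym (ℕₚ.+-identityʳ n))))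
        (ℚₚ.+-mono-≤ F≤nls F≤nls))
    t²< : (t ×ℚ 1ℚ) ℚ.* (t ×ℚ 1ℚ) ℚ.< (2 ℕ.* n) ×ℚ (ls ℚ.+ recip 3)
    t²< = subst (ℚ._< (2 ℕ.* n) ×ℚ (ls ℚ.+ recip 3)) (sym (sq-×ℚ t))
      (ℚₚ.≤-<-trans t²≤2nls (×ℚ-monoʳ-< (2 ℕ.* n) {{ℕₚ.m*n≢0 2 n}}
        (by-gap {ls} {ls ℚ.+ recip 3} (recip 3) (recip-pos 3) refl)))

-- Rational witnesses for the final inequality.

p+q-q≡p : ∀ p q → p ℚ.+ q ℚ.- q ≡ p
p+q-q≡p p q = trans (ℚₚ.+-assoc p q (ℚ.- q))
  (trans (cong (λ z → p ℚ.+ z) (ℚₚ.+-inverseʳ q)) (ℚₚ.+-identityʳ p))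

neg-neg : ∀ p → ℚ.- (ℚ.- p) ≡ p
neg-neg = ⁻¹-involutive ℚₚ.+-0-abelianGroup

fromℚ-ℝ<fromℚ : ∀ x {a b r} → ℝ.L x r → a ℚ.< b ℚ.+ r → fromℚ a -ℝ x <ℝ fromℚ b
fromℚ-ℝ<fromℚ x {a} {b} {r} Lr a<b+r =
  -- `c` lies above a and `- r` above -x, so any `q` between c - r and b separates a - x from b.
  let (c , a<c , c<b+r) = ℚₚ.<-dense a<b+r
      c-r<b = subst (c ℚ.- r ℚ.<_) (p+q-q≡p b r) (ℚₚ.+-monoˡ-< (ℚ.- r) c<b+r)
      (q , c-r<q , q<b) = ℚₚ.<-dense c-r<b
  in q , (c , ℚ.- r , a<c , subst (ℝ.L x) (sym (neg-neg r)) Lr , c-r<q) , q<b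

fromℤ-ℝ<fromℤ : ∀ x {r} m k → ℝ.L x r → m ×ℚ 1ℚ ℚ.< k ×ℚ 1ℚ ℚ.+ r →
  fromℤ (+ m) -ℝ x <ℝ fromℤ (+ k)
fromℤ-ℝ<fromℤ x m k Lr m<k+r =
  subst₂ (λ a b → fromℚ a -ℝ x <ℝ fromℚ b) (×ℚ-recip m 0) (×ℚ-recip k 0)
    (fromℚ-ℝ<fromℚ x Lr m<k+r)

-- Here k > n, so it is enough that the root exceeds -½, a member of the lower cut of every `√`.
K-bound-trivial : ∀ n .{{_ : NonZero n}} k′ → n ℕ.≤ k′ →
  fromℤ (+ n) -ℝ √ ((2 ℕ.* n) · (log n +ℝ fromℤ (+ 1))) <ℝ fromℤ (+ suc k′)
K-bound-trivial n k′ n≤k′ =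
  fromℤ-ℝ<fromℤ (√ ((2 ℕ.* n) · (log n +ℝ fromℤ (+ 1)))) n (suc k′) (inj₁ -½<0)
    (ℚₚ.≤-<-trans (×ℚ-mono-≤ n≤k′ ℚₚ.≤-refl 0≤1)
      (by-gap ½ 0<½ (solve 1 (λ p → p :+ con ½ := con 1ℚ :+ p :+ con (ℚ.- ½)) refl (k′ ×ℚ 1ℚ))))
  where
    open +-*-Solver
    -½<0 : ℚ.- ½ ℚ.< 0ℚ
    -½<0 = *<* ℤ.-<+

K-bound : ∀ n .{{_ : NonZero n}} s k′ → suc k′ ℕ.+ s ≡ n → ((+ suc k′) -removable) (K n n) →
  fromℤ (+ n) -ℝ √ ((2 ℕ.* n) · (log n +ℝ fromℤ (+ 1))) <ℝ fromℤ (+ suc k′)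
K-bound n s k′ k+s≡n rem =
  fromℤ-ℝ<fromℤ (√ ((2 ℕ.* n) · (log n +ℝ fromℤ (+ 1)))) n (suc k′)
    (√-L n (suc s) k′ (subst (λ z → k′ ℕ.≤ z ℕ.∸ 1) k+s≡n (ℕₚ.m≤m+n k′ s))
      (K-removable⇒square≤ s k′ k+s≡n rem))
    n<k+t
  where
    -- The rational below the root is t = n - k + 1; the extra one makes the comparison with n - k
    -- strict.
    n<k+t : n ×ℚ 1ℚ ℚ.< suc k′ ×ℚ 1ℚ ℚ.+ suc s ×ℚ 1ℚ
    n<k+t = subst (n ×ℚ 1ℚ ℚ.<_)
      (trans (cong (_×ℚ 1ℚ) (trans (cong suc (sym k+s≡n)) (sym (ℕₚ.+-suc (suc k′) s))))
        (×ℚ-+ (suc k′) (suc s) 1ℚ))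
      (by-gap 1ℚ 0<1 (ℚₚ.+-comm (n ×ℚ 1ℚ) 1ℚ))

open import Data.Nat.Base using (_*_)

theorem4p6 : (n : ℕ) .{{_ : NonZero n}} (k : ℤ) → (k -removable) (K n n) →
    fromℤ (+ n) -ℝ √ ((2 * n) · (log n +ℝ fromℤ (+ 1))) <ℝ fromℤ k
theorem4p6 n k rem = by-sign k rem (K-removable⇒positive n k rem)
  where
    Bound : ℤ → Set
    Bound k = fromℤ (+ n) -ℝ √ ((2 * n) · (log n +ℝ fromℤ (+ 1))) <ℝ fromℤ k

    by-size : ∀ k′ → ((+ suc k′) -removable) (K n n) →
      n ℕ.≤ k′ ⊎ (∃ λ s → suc k′ ℕ.+ s ≡ n) → Bound (+ suc k′)
    by-size k′ rem (inj₁ n≤k′)        = K-bound-trivial n k′ n≤k′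
    by-size k′ rem (inj₂ (s , k+s≡n)) = K-bound n s k′ k+s≡n rem

    by-sign : ∀ k → (k -removable) (K n n) → 1ℤ ℤ.≤ k → Bound k
    by-sign (+ suc k′) rem (+≤+ (s≤s _)) = by-size k′ rem
      (Sum.map₂ (λ k′<n → ℕₚ.m≤n⇒∃[o]m+o≡n k′<n) (ℕₚ.≤-<-connex n k′))
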